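{- Let $h\colon[n]\to[n]$ be a Hessenberg function and let $w\in\mathfrak S_n$ be a generator for $h$. If $w$ contains one of the associated patterns $[2143]_h$, $[1324]_h$, $[1243]_h$, $[2134]_h$, $[1423]_h$, $[2314]_h$, $[2413]_h$, then the graph $\Gamma_{w,h}$ is not regular.
   Context: A Hessenberg function is a nondecreasing $h\colon[n]\to[n]$ with $h(i)\ge i$. For $u\in\mathfrak S_n$ (one-line notation) and $i<j$, $u(i,j)$ is obtained from $u$ by swapping the entries in positions $i$ and $j$. The Bruhat order $\preceq$ is the reflexive–transitive closure of $u\prec u(i,j)$ when $u(i,j)$ has more inversions than $u$; $w_0=n(n-1)\cdots1$, $[w,w_0]=\{u\mid w\preceq u\preceq w_0\}$. A generator for $h$ is a $w$ with $w^{ -1}(w(i)+1)\le h(i)$ whenever $w(i)\le n-1$. $\Gamma_h$ is the graph with vertex set $\mathfrak S_n$ and edges $\{u,u(i,j)\}$ for $1\le i<j\le h(i)$; for a generator $w$, $\Gamma_{w,h}$ is the subgraph of $\Gamma_h$ induced on $[w,w_0]$ (this vertex set is the set of torus fixed points of the Hessenberg Schubert variety $\Omega_{w,h}$). A graph is regular if all vertices have the same degree. Associated patterns: $w$ contains $[2143]_h$ if $w(j)<w(i)<w(\ell)<w(k)$ for some $i<j<k<\ell\le h(i)$; $[1324]_h$ if $w(i)<w(k)<w(j)<w(\ell)$ for some $i<j<k<\ell\le h(j)$ with $k\le h(i)$; $[1243]_h$ if $w(i)<w(j)<w(\ell)<w(k)$ for some $i<j<k<\ell\le h(j)$ with $j\le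 h(i)<\ell$; $[2134]_h$ if $w(j)<w(i)<w(k)<w(\ell)$ for some $i<j<k<\ell\le h(k)$ with $k\le h(i)<\ell$; $[1423]_h$ if $w(i)<w(k)<w(\ell)<w(j)$ for some $i<j<k<\ell\le h(j)$ with $k\le h(i)<\ell$; $[2314]_h$ if $w(k)<w(i)<w(j)<w(\ell)$ for some $i<j<k<\ell\le h(j)$ with $k\le h(i)<\ell$; $[2413]_h$ if $w(k)<w(i)<w(\ell)<w(j)$ for some $i<j\le h(i)<k\le h(j)<\ell\le h(k)$. -}

module Defs where

open import Data.Nat using (ℕ; suc) renaming (_<_ to _<ℕ_)
open import Data.Fin using (Fin; toℕ; _<_; _≤_; _<?_)
open import Data.Fin.Permutation using (Permutation′; _⟨$⟩ʳ_; _⟨$⟩ˡ_; _∘ₚ_; transpose; reverse; _≈_)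
open import Data.List using (List; length; filter; cartesianProduct; allFin)
open import Data.Product using (_×_; _,_; Σ; ∃; ∃-syntax)
open import Data.Sum using (_⊎_)
open import Relation.Nullary using (¬_; Dec)
open import Relation.Nullary.Decidable using (_×-dec_)
open import Relation.Binary.PropositionalEquality using (_≡_)

-- Permutations of [n] = Fin n (0-based positions/values), in one-line
-- notation: u(i) = u ⟨$⟩ʳ i.
Perm : ℕ → Set
Perm n = Permutation′ n

_at_ : ∀ {n} → Perm n → Fin n → Fin n
u at i = u ⟨$⟩ʳ i

swapPos : ∀ {n} → Perm n → Fin n → Fin n → Perm n
swapPos u i j = transpose i j ∘ₚ u

inv : ∀ {n} → Perm n → ℕ
inv {n} u = length (filter (λ p → isInv p) (cartesianProduct (allFin n) (allFin n)))
  where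
  isInv : (p : Fin n × Fin n) → Dec (let (i , j) = p in (i < j) × (u at j < u at i))
  isInv (i , j) = (i <? j) ×-dec ((u at j) <? (u at i))

BruhatStep : ∀ {n} → Perm n → Perm n → Set
BruhatStep u v = ∃[ i ] ∃[ j ] ((i < j) × (v ≈ swapPos u i j) × (inv u <ℕ inv v))

data _≼_ {n : ℕ} : Perm n → Perm n → Set where
  ≼-refl : ∀ {u v} → u ≈ v → u ≼ v
  ≼-step : ∀ {u v x} → BruhatStep u x → x ≼ v → u ≼ v

w₀ : ∀ {n} → Perm n
w₀ = reverse

InInterval : ∀ {n} → Perm n → Perm n → Set
InInterval w u = (w ≼ u) × (u ≼ w₀)

record Hessenberg (n : ℕ) : Set where
  field
    h        : Fin n → Fin n
    monotone : ∀ {i j} → i ≤ j → h i ≤ h j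
    extensive : ∀ i → i ≤ h i
open Hessenberg public

-- generator for h: whenever w(i) ≤ n-1 (1-based), i.e. w(i)+1 is a value,
-- w⁻¹(w(i)+1) ≤ h(i)
IsGenerator : ∀ {n} → Hessenberg n → Perm n → Set
IsGenerator {n} H w =
  ∀ (i k : Fin n) → toℕ k ≡ suc (toℕ (w at i)) → (w ⟨$⟩ˡ k) ≤ h H i

Adjacent : ∀ {n} → Hessenberg n → Perm n → Perm n → Set
Adjacent H u v = ∃[ i ] ∃[ j ] ((i < j) × (j ≤ h H i) × (v ≈ swapPos u i j))

HasDegree : ∀ {n} → Hessenberg n → Perm n → Perm n → ℕ → Set
HasDegree {n} H w u d =
  Σ (Fin d → Perm n) λ f →
      (∀ a b → f a ≈ f b → a ≡ b)
    × (∀ a → InInterval w (f a) × Adjacent H u (f a))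
    × (∀ v → InInterval w v → Adjacent H u v → ∃[ a ] (f a ≈ v))

IsRegular : ∀ {n} → Hessenberg n → Perm n → Set
IsRegular H w = ∃[ d ] (∀ u → InInterval w u → HasDegree H w u d)

module _ {n : ℕ} (H : Hessenberg n) (w : Perm n) where
  private
    hh = h H
    W = w at_

  Contains2143 : Set
  Contains2143 = ∃[ i ] ∃[ j ] ∃[ k ] ∃[ ℓ ] ((i < j) × (j < k) × (k < ℓ) × (ℓ ≤ hh i)
    × (W j < W i) × (W i < W ℓ) × (W ℓ < W k))

  Contains1324 : Set
  Contains1324 = ∃[ i ] ∃[ j ] ∃[ k ] ∃[ ℓ ] ((i < j) × (j < k) × (k < ℓ) × (ℓ ≤ hh j) × (k ≤ hh i)
    × (W i < W k) × (W k < W j) × (W j < W ℓ))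

  Contains1243 : Set
  Contains1243 = ∃[ i ] ∃[ j ] ∃[ k ] ∃[ ℓ ] ((i < j) × (j < k) × (k < ℓ) × (ℓ ≤ hh j)
    × (j ≤ hh i) × (hh i < ℓ)
    × (W i < W j) × (W j < W ℓ) × (W ℓ < W k))

  Contains2134 : Set
  Contains2134 = ∃[ i ] ∃[ j ] ∃[ k ] ∃[ ℓ ] ((i < j) × (j < k) × (k < ℓ) × (ℓ ≤ hh k)
    × (k ≤ hh i) × (hh i < ℓ)
    × (W j < W i) × (W i < W k) × (W k < W ℓ))

  Contains1423 : Set
  Contains1423 = ∃[ i ] ∃[ j ] ∃[ k ] ∃[ ℓ ] ((i < j) × (j < k) × (k < ℓ) × (ℓ ≤ hh j)
    × (k ≤ hh i) × (hh i < ℓ)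
    × (W i < W k) × (W k < W ℓ) × (W ℓ < W j))

  Contains2314 : Set
  Contains2314 = ∃[ i ] ∃[ j ] ∃[ k ] ∃[ ℓ ] ((i < j) × (j < k) × (k < ℓ) × (ℓ ≤ hh j)
    × (k ≤ hh i) × (hh i < ℓ)
    × (W k < W i) × (W i < W j) × (W j < W ℓ))

  Contains2413 : Set
  Contains2413 = ∃[ i ] ∃[ j ] ∃[ k ] ∃[ ℓ ] ((i < j) × (j ≤ hh i) × (hh i < k) × (k ≤ hh j)
    × (hh j < ℓ) × (ℓ ≤ hh k)
    × (W k < W i) × (W i < W ℓ) × (W ℓ < W j))

  ContainsAssociatedPattern : Set
  ContainsAssociatedPattern =
    Contains2143 ⊎ Contains1324 ⊎ Contains1243 ⊎ Contains2134
      ⊎ Contains1423 ⊎ Contains2314 ⊎ Contains2413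

{-# OPTIONS --safe #-}
-- Let u be obtained from w by sorting the four entries of the pattern decreasingly; then
-- deg u > deg w.  The neighbours of w in [w , w₀] are the w (i , j) for ascending h-edges
-- i < j ≤ h(i), and these edges inject into the h-edges of u that stay above w.  An edge with
-- no end in the pattern is kept: it is ascending in u too.  For a position p outside the
-- pattern and either side of p, the k-th nearest pattern position on that side forming an
-- ascending pair with p is sent to the k-th nearest pattern position on that side: the edge
-- gets shorter, hence remains an h-edge, and u (p , q) ≽ w can be checked on the five
-- positions involved, i.e. in S₅.  Edges inside the pattern are kept or shortened, and there
-- at least one edge of u is left over.
module Submission where

open import Defs
open import Data.Bool using (T; T?)
open import Data.Fin using (Fin; zero; suc; toℕ; opposite; punchIn; punchOut; _<_; _≤_; _<?_; _≤?_)
open import Data.Fin.Patterns using (0F; 1F; 2F; 3F)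
open import Data.Fin.Permutation using (_≈_; _⟨$⟩ˡ_; inverseˡ)
open import Data.Fin.Permutation.Components using (transpose; transpose-inverse)
open import Data.Fin.Properties using (_≟_; all?; any?; <-cmp; <-trans; <-irrefl; <-asym; <⇒≢; ≤-antisym; toℕ<n; toℕ≤pred[n]; opposite-prop; opposite-involutive; injective⇒≤; punchIn-punchOut; punchInᵢ≢i)
open import Data.List as List using (List; []; _∷_; _++_; length; filter; cartesianProduct; allFin; zip; reverse; mapMaybe)
open import Data.List.Membership.Propositional using (_∈_)
open import Data.List.Membership.Propositional.Properties using (∈-filter⁺; ∈-filter⁻; ∈-cartesianProduct⁺; ∈-allFin; ∈-lookup)
open import Data.List.Properties using (length-filter; filter-≐)
import Data.List.Relation.Unary.All as All
open import Data.List.Relation.Unary.AllPairs using (_∷_)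
open import Data.List.Relation.Unary.Any using (index)
open import Data.List.Relation.Unary.Any.Properties using (lookup-index)
open import Data.List.Relation.Unary.Unique.Propositional using (Unique)
import Data.List.Relation.Unary.Unique.Propositional.Properties as Unique
open import Data.Maybe as Maybe using (Maybe; just; nothing; is-just; to-witness-T)
open import Data.Nat as ℕ using (ℕ; zero; suc; s≤s; z≤n)
import Data.Nat.Properties as ℕ
open import Data.Product using (_×_; _,_; ∃-syntax; proj₁; proj₂)
open import Data.Product.Properties using (≡-dec; ,-injectiveˡ; ,-injectiveʳ)
open import Data.Sum as Sum using (_⊎_; inj₁; inj₂)
open import Data.Vec using (Vec; []; _∷_; lookup; tabulate; _[_]≔_)
open import Data.Vec.Functional using (insertAt)
open import Data.Vec.Functional.Properties using (insertAt-lookup; insertAt-punchIn)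
import Data.Vec.Properties as Vec
open import Data.Vec.Properties using (lookup∘update; lookup∘update′; lookup∘tabulate)
open import Function using (_∘_; id)
open import Relation.Binary using (tri<; tri≈; tri>)
open import Relation.Binary.PropositionalEquality using (_≡_; _≢_; refl; sym; trans; cong; cong₂; subst; subst₂)
open import Relation.Nullary using (¬_; Dec; yes; no; contradiction)
open import Relation.Nullary.Decidable using (_×-dec_; _⊎-dec_; _→-dec_; ¬?; map′; toWitness; dec⇒maybe)
open import Relation.Unary using (Decidable)

private variable
  m k n : ℕ

-- Counting by injections

-- Adding the missed value `z` as the image of one further point gives an injection from
-- `Fin (suc m)`.
injective-missing⇒< : (f : Fin m → Fin k) (z : Fin k) → (∀ {i j} → f i ≡ f j → i ≡ j) →
                      (∀ i → f i ≢ z) → m ℕ.< k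
injective-missing⇒< f z inj miss = injective⇒≤ {f = g} g-injective
  where
  g : Fin (suc _) → Fin _
  g zero    = z
  g (suc i) = f i
  g-injective : ∀ {i j} → g i ≡ g j → i ≡ j
  g-injective {zero}  {zero}  eq = refl
  g-injective {zero}  {suc j} eq = contradiction (sym eq) (miss j)
  g-injective {suc i} {zero}  eq = contradiction eq (miss i)
  g-injective {suc i} {suc j} eq = cong suc (inj eq)

lookup-injective : ∀ {A : Set} {xs : List A} → Unique xs → ∀ i j →
                   List.lookup xs i ≡ List.lookup xs j → i ≡ j
lookup-injective (x∉ ∷ u) zero    zero    eq = refl
lookup-injective (x∉ ∷ u) zero    (suc j) eq = contradiction eq (All.lookup x∉ (∈-lookup j))
lookup-injective (x∉ ∷ u) (suc i) zero    eq = contradiction (sym eq) (All.lookup x∉ (∈-lookup i))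
lookup-injective (x∉ ∷ u) (suc i) (suc j) eq = cong suc (lookup-injective u i j eq)

-- The count is made on positions: each position of `xs` goes to a position in `ys` holding its
-- image. As `xs` has no repetitions, equal positions in `ys` come from one position of `xs`.
length-< : ∀ {A B : Set} {xs : List A} {ys : List B} → Unique xs →
           (φ : A → B) (z : B) → z ∈ ys →
           (∀ {x} → x ∈ xs → φ x ∈ ys × φ x ≢ z) →
           (∀ {x y} → x ∈ xs → y ∈ xs → φ x ≡ φ y → x ≡ y) →
           length xs ℕ.< length ys
length-< {xs = xs} {ys} unique φ z z∈ φ∈ φ-inj =
  injective-missing⇒< f (index z∈) f-inj λ i eq →
    proj₂ (φ∈ (∈-lookup i)) (trans (at-f i) (trans (cong (List.lookup ys) eq) (sym (lookup-index z∈))))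
  where
  f : Fin (length xs) → Fin (length ys)
  f i = index (proj₁ (φ∈ (∈-lookup {xs = xs} i)))
  at-f : ∀ i → φ (List.lookup xs i) ≡ List.lookup ys (f i)
  at-f i = lookup-index (proj₁ (φ∈ (∈-lookup {xs = xs} i)))
  f-inj : ∀ {i j} → f i ≡ f j → i ≡ j
  f-inj {i} {j} eq = lookup-injective unique i j
    (φ-inj (∈-lookup i) (∈-lookup j) (trans (at-f i) (trans (cong (List.lookup ys) eq) (sym (at-f j)))))

-- Inversions and the Bruhat order

transpose-ˡ : ∀ (i j : Fin n) → transpose i j i ≡ j
transpose-ˡ i j with i ≟ i
... | yes _  = refl
... | no i≢i = contradiction refl i≢i

transpose-ʳ : ∀ (i j : Fin n) → transpose i j j ≡ i
transpose-ʳ i j with j ≟ i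
... | yes j≡i = j≡i
... | no  _ with j ≟ j
...   | yes _  = refl
...   | no j≢j = contradiction refl j≢j

transpose-≢ : ∀ (i j : Fin n) {k} → k ≢ i → k ≢ j → transpose i j k ≡ k
transpose-≢ i j {k} k≢i k≢j with k ≟ i
... | yes k≡i = contradiction k≡i k≢i
... | no  _ with k ≟ j
...   | yes k≡j = contradiction k≡j k≢j
...   | no  _   = refl

data TransposeView (i j : Fin n) (k : Fin n) : Set where
  first  : k ≡ i → transpose i j k ≡ j → TransposeView i j k
  second : k ≡ j → transpose i j k ≡ i → TransposeView i j k
  other  : k ≢ i → k ≢ j → transpose i j k ≡ k → TransposeView i j k

transposeView : ∀ (i j k : Fin n) → TransposeView i j k
transposeView i j k with k ≟ i | k ≟ j
... | yes refl | _        = first refl (transpose-ˡ i j)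
... | no  _    | yes refl = second refl (transpose-ʳ i j)
... | no k≢i   | no k≢j   = other k≢i k≢j (transpose-≢ i j k≢i k≢j)

transpose-comm : ∀ (i j k : Fin n) → transpose i j k ≡ transpose j i k
transpose-comm i j k with transposeView i j k
... | first  refl eq    = trans eq (sym (transpose-ʳ j i))
... | second refl eq    = trans eq (sym (transpose-ˡ j i))
... | other k≢i k≢j eq = trans eq (sym (transpose-≢ j i k≢j k≢i))

transpose-involutive : ∀ (i j k : Fin n) → transpose i j (transpose i j k) ≡ k
transpose-involutive i j k = trans (transpose-comm i j (transpose i j k)) (transpose-inverse j i)

transpose-injective : ∀ (i j : Fin n) {k l} → transpose i j k ≡ transpose i j l → k ≡ l
transpose-injective i j {k} {l} eq =
  trans (sym (transpose-involutive i j k)) (trans (cong (transpose i j) eq) (transpose-involutive i j l))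

at-injective : ∀ (u : Perm n) {i j} → u at i ≡ u at j → i ≡ j
at-injective u {i} {j} eq =
  trans (sym (inverseˡ u)) (trans (cong (u ⟨$⟩ˡ_) eq) (inverseˡ u))

Inversion : Perm n → Fin n × Fin n → Set
Inversion u (i , j) = (i < j) × (u at j < u at i)

inversion? : ∀ (u : Perm n) → Decidable (Inversion u)
inversion? u (i , j) = (i <? j) ×-dec (u at j <? u at i)

positionPairs : ∀ n → List (Fin n × Fin n)
positionPairs n = cartesianProduct (allFin n) (allFin n)

inversions : Perm n → List (Fin n × Fin n)
inversions {n} u = filter (inversion? u) (positionPairs n)

inversions-unique : ∀ (u : Perm n) → Unique (inversions u)
inversions-unique {n} u = Unique.filter⁺ (inversion? u) (Unique.cartesianProduct⁺ (Unique.allFin⁺ n) (Unique.allFin⁺ n))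

∈-inversions⁺ : ∀ (u : Perm n) {p} → Inversion u p → p ∈ inversions u
∈-inversions⁺ u = ∈-filter⁺ (inversion? u) (∈-cartesianProduct⁺ (∈-allFin _) (∈-allFin _))

∈-inversions⁻ : ∀ (u : Perm n) {p} → p ∈ inversions u → Inversion u p
∈-inversions⁻ {n} u p∈ = proj₂ (∈-filter⁻ (inversion? u) {xs = positionPairs n} p∈)

inv-cong : ∀ {u v : Perm n} → u ≈ v → inv u ≡ inv v
inv-cong {n} {u} {v} u≈v = cong length (filter-≐ (inversion? u) (inversion? v) (to , from) (positionPairs n))
  where
  to : ∀ {p} → Inversion u p → Inversion v p
  to (lt , gt) = lt , subst₂ _<_ (u≈v _) (u≈v _) gt
  from : ∀ {p} → Inversion v p → Inversion u p
  from (lt , gt) = lt , subst₂ _<_ (sym (u≈v _)) (sym (u≈v _)) gt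

-- Conjugating an inversion by (i j) gives an inversion of u (i j) unless (i j) reverses the
-- order of its two positions, in which case the same pair is still an inversion of u (i j).
inv-swapPos : ∀ (u : Perm n) {i j} → i < j → u at i < u at j → inv u ℕ.< inv (swapPos u i j)
inv-swapPos {n} u {i} {j} i<j ui<uj =
  length-< (inversions-unique u) φ (i , j) (∈-inversions⁺ v (i<j , vj<vi))
    (λ x∈ → let inversion , ≢ij = φ-inversion (∈-inversions⁻ u x∈) in ∈-inversions⁺ v inversion , ≢ij)
    (λ x∈ y∈ → φ-injective (∈-inversions⁻ u x∈) (∈-inversions⁻ u y∈))
  where
  v : Perm n
  v = swapPos u i j
  t : Fin n → Fin n
  t = transpose i j
  φ : Fin n × Fin n → Fin n × Fin n
  φ (a , b) with t a <? t b
  ... | yes _ = t a , t b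
  ... | no  _ = a , b
  vj<vi : v at j < v at i
  vj<vi = subst₂ (λ a b → u at a < u at b) (sym (transpose-ʳ i j)) (sym (transpose-ˡ i j)) ui<uj
  -- Only `a ≡ i` or `b ≡ j`, not both, survives the hypotheses; there the inversion of `u` chains
  -- with `u at i < u at j`.
  still : ∀ {a b} → a < b → u at b < u at a → ¬ (t a < t b) → v at b < v at a
  still {a} {b} a<b ub<ua ta≮tb with transposeView i j a | transposeView i j b
  ... | first refl _  | first refl _ = contradiction a<b (<-irrefl refl)
  ... | first refl _  | second refl _ = contradiction ui<uj (<-asym ub<ua)
  ... | first refl ta | other _ _ tb rewrite ta | tb = <-trans ub<ua ui<uj
  ... | second refl _ | first refl _ = contradiction a<b (<-asym i<j)
  ... | second refl _ | second refl _ = contradiction a<b (<-irrefl refl)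
  ... | second refl ta | other _ _ tb rewrite ta | tb = contradiction (<-trans i<j a<b) ta≮tb
  ... | other _ _ ta | first refl tb rewrite ta | tb = contradiction (<-trans a<b i<j) ta≮tb
  ... | other _ _ ta | second refl tb rewrite ta | tb = <-trans ui<uj ub<ua
  ... | other _ _ ta | other _ _ tb rewrite ta | tb = contradiction a<b ta≮tb
  φ-inversion : ∀ {p} → Inversion u p → Inversion v (φ p) × φ p ≢ (i , j)
  φ-inversion {a , b} (a<b , ub<ua) with t a <? t b
  ... | yes ta<tb =
    (ta<tb , subst₂ (λ x y → u at x < u at y) (sym (transpose-involutive i j b)) (sym (transpose-involutive i j a)) ub<ua)
    -- A conjugate equal to `(i , j)` could only come from `(j , i)`, which is out of order.
    , λ eq → <-asym a<b (subst₂ _<_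
        (trans (sym (transpose-ʳ i j)) (trans (cong t (sym (,-injectiveʳ eq))) (transpose-involutive i j b)))
        (trans (sym (transpose-ˡ i j)) (trans (cong t (sym (,-injectiveˡ eq))) (transpose-involutive i j a))) i<j)
  ... | no ta≮tb = (a<b , still a<b ub<ua ta≮tb) , λ { refl → <-asym ub<ua ui<uj }
  φ-injective : ∀ {p q} → Inversion u p → Inversion u q → φ p ≡ φ q → p ≡ q
  φ-injective {a , b} {c , d} (a<b , _) (c<d , _) eq with t a <? t b | t c <? t d
  ... | yes _ | yes _ = cong₂ _,_ (transpose-injective i j (,-injectiveˡ eq)) (transpose-injective i j (,-injectiveʳ eq))
  ... | no  _ | no  _ = eq
  -- A conjugated and an unchanged pair cannot collide: if `(t a , t b)` is `(c , d)`, then `t c` is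
  -- `a` and `t d` is `b`, which are in order.
  ... | yes _ | no tc≮td = contradiction
    (subst₂ _<_ (trans (sym (transpose-involutive i j a)) (cong t (,-injectiveˡ eq)))
                (trans (sym (transpose-involutive i j b)) (cong t (,-injectiveʳ eq))) a<b) tc≮td
  ... | no ta≮tb | yes _ = contradiction
    (subst₂ _<_ (trans (sym (transpose-involutive i j c)) (cong t (sym (,-injectiveˡ eq))))
                (trans (sym (transpose-involutive i j d)) (cong t (sym (,-injectiveʳ eq)))) c<d) ta≮tb

swapPos-step : ∀ (u : Perm n) {i j} → i < j → u at i < u at j → BruhatStep u (swapPos u i j)
swapPos-step u i<j ui<uj = _ , _ , i<j , (λ _ → refl) , inv-swapPos u i<j ui<uj

≼⇒inv≤ : ∀ {u v : Perm n} → u ≼ v → inv u ℕ.≤ inv v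
≼⇒inv≤ {u = u} {v} (≼-refl u≈v) = ℕ.≤-reflexive (inv-cong {u = u} {v} u≈v)
≼⇒inv≤ (≼-step (_ , _ , _ , _ , lt) x≼v) = ℕ.≤-trans (ℕ.<⇒≤ lt) (≼⇒inv≤ x≼v)

≼-respʳ-≈ : ∀ {u v v′ : Perm n} → u ≼ v → v ≈ v′ → u ≼ v′
≼-respʳ-≈ (≼-refl u≈v)       v≈v′ = ≼-refl (λ i → trans (u≈v i) (v≈v′ i))
≼-respʳ-≈ (≼-step step x≼v) v≈v′ = ≼-step step (≼-respʳ-≈ x≼v v≈v′)

≼-respˡ-≈ : ∀ {u u′ v : Perm n} → u′ ≈ u → u ≼ v → u′ ≼ v
≼-respˡ-≈ u′≈u (≼-refl u≈v) = ≼-refl (λ i → trans (u′≈u i) (u≈v i))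
≼-respˡ-≈ {u = u} {u′} u′≈u (≼-step {x = x} (i , j , i<j , x≈ , lt) x≼v) =
  ≼-step (i , j , i<j , (λ y → trans (x≈ y) (sym (u′≈u _))) , subst (ℕ._< inv x) (sym (inv-cong {u = u′} {u} u′≈u)) lt) x≼v

≼-trans : ∀ {u v x : Perm n} → u ≼ v → v ≼ x → u ≼ x
≼-trans (≼-refl u≈v)       v≼x = ≼-respˡ-≈ u≈v v≼x
≼-trans (≼-step step y≼v) v≼x = ≼-step step (≼-trans y≼v v≼x)

-- Otherwise swapping back is an ascending swap from `v` to `u`, so `inv v < inv u`, while going up
-- in `≼` never lowers `inv`.
≼-swapPos⇒< : ∀ (u : Perm n) {v i j} → i < j → v ≈ swapPos u i j → u ≼ v → u at i < u at j
≼-swapPos⇒< u {v} {i} {j} i<j v≈ u≼v with <-cmp (u at i) (u at j)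
... | tri< ui<uj _ _ = ui<uj
... | tri≈ _ ui≡uj _ = contradiction (at-injective u ui≡uj) (<⇒≢ i<j)
... | tri> _ _ uj<ui = contradiction (≼⇒inv≤ u≼v) (ℕ.<⇒≱ inv-v<inv-u)
  where
  vi<vj : v at i < v at j
  vi<vj = subst₂ _<_ (sym (trans (v≈ i) (cong (u at_) (transpose-ˡ i j)))) (sym (trans (v≈ j) (cong (u at_) (transpose-ʳ i j)))) uj<ui
  back : swapPos v i j ≈ u
  back x = trans (v≈ _) (cong (u at_) (transpose-involutive i j x))
  inv-v<inv-u : inv v ℕ.< inv u
  inv-v<inv-u = subst (inv v ℕ.<_) (inv-cong {u = swapPos v i j} {v = u} back) (inv-swapPos v i<j vi<vj)

-- Strictly monotone maps and the maximality of `w₀`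

StrictMono : (Fin m → Fin n) → Set
StrictMono f = ∀ {a b} → a < b → f a < f b

strictMono⇒≤ : ∀ (f : Fin m → Fin n) → StrictMono f → ∀ i → i ≤ f i
strictMono⇒≤ f mono = go (toℕ ∘ f) mono 0 (λ _ → z≤n)
  where
  go : ∀ {m} (g : Fin m → ℕ) → (∀ {a b} → a < b → g a ℕ.< g b) →
       ∀ base → (∀ i → base ℕ.≤ g i) → ∀ i → base ℕ.+ toℕ i ℕ.≤ g i
  go g mono base bound zero    = ℕ.≤-trans (ℕ.≤-reflexive (ℕ.+-identityʳ base)) (bound zero)
  go g mono base bound (suc i) = ℕ.≤-trans (ℕ.≤-reflexive (ℕ.+-suc base (toℕ i)))
    (go (g ∘ suc) (mono ∘ s≤s) (suc base) (λ j → ℕ.≤-<-trans (bound zero) (mono (s≤s z≤n))) i)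

opposite-strictAnti : ∀ {i j : Fin n} → i < j → opposite j < opposite i
opposite-strictAnti {n} {i} {j} i<j = subst₂ ℕ._<_ (sym (opposite-prop j)) (sym (opposite-prop i))
  (ℕ.∸-monoʳ-< (s≤s i<j) (toℕ<n j))

opposite-anti : ∀ {i j : Fin n} → i ≤ j → opposite j ≤ opposite i
opposite-anti {n} {i} {j} i≤j = subst₂ ℕ._≤_ (sym (opposite-prop j)) (sym (opposite-prop i))
  (ℕ.∸-monoʳ-≤ n (s≤s i≤j))

-- Composing with `opposite` on the left and on the right gives two strictly increasing self-maps;
-- the bound for such maps yields one inequality each.
strictAnti⇒opposite : ∀ (f : Fin n → Fin n) → (∀ {a b} → a < b → f b < f a) → ∀ i → f i ≡ opposite i
strictAnti⇒opposite f anti i = ≤-antisym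
  (subst₂ _≤_ (opposite-involutive (f i)) refl
    (opposite-anti (strictMono⇒≤ (opposite ∘ f) (opposite-strictAnti ∘ anti) i)))
  (subst (λ x → opposite i ≤ f x) (opposite-involutive i)
    (strictMono⇒≤ (f ∘ opposite) (anti ∘ opposite-strictAnti) (opposite i)))

-- Any ascent can be swapped, which raises `inv`. The number of position pairs bounds `inv`, so fuel
-- covering the difference suffices. Without ascents the permutation is strictly decreasing, hence
-- `w₀`.
≼-w₀ : ∀ (u : Perm n) → u ≼ w₀
≼-w₀ {n} u = go (length (positionPairs n)) u (ℕ.m≤m+n _ _)
  where
  go : ∀ fuel (u : Perm n) → length (positionPairs n) ℕ.≤ fuel ℕ.+ inv u → u ≼ w₀
  go fuel u bound with any? (λ i → any? (λ j → (i <? j) ×-dec (u at i <? u at j)))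
  go fuel u bound | no noAscent = ≼-refl (strictAnti⇒opposite (u at_) anti)
    where
    anti : ∀ {a b} → a < b → u at b < u at a
    anti {a} {b} a<b with <-cmp (u at a) (u at b)
    ... | tri< lt _ _ = contradiction (a , b , a<b , lt) noAscent
    ... | tri≈ _ eq _ = contradiction (at-injective u eq) (<⇒≢ a<b)
    ... | tri> _ _ gt = gt
  go zero u bound | yes (i , j , i<j , ui<uj) =
    contradiction (ℕ.<-≤-trans (inv-swapPos u i<j ui<uj) (length-filter (inversion? (swapPos u i j)) (positionPairs n))) (ℕ.≤⇒≯ bound)
  go (suc fuel) u bound | yes (i , j , i<j , ui<uj) = ≼-step (swapPos-step u i<j ui<uj)
    (go fuel (swapPos u i j) (ℕ.≤-trans bound
      (subst (ℕ._≤ fuel ℕ.+ inv (swapPos u i j)) (ℕ.+-suc fuel (inv u)) (ℕ.+-monoʳ-≤ fuel (inv-swapPos u i<j ui<uj)))))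

-- Finite checks in S₄ and S₅

swapAt : Vec (Fin k) m → Fin m → Fin m → Vec (Fin k) m
swapAt τ a b = (τ [ a ]≔ lookup τ b) [ b ]≔ lookup τ a

-- A Bruhat chain whose steps are witnessed by ascents instead of inversion counts, because ascents
-- are what increasing embeddings preserve.
data _⊑_ {k m : ℕ} : Vec (Fin k) m → Vec (Fin k) m → Set where
  ⊑-refl : ∀ {τ} → τ ⊑ τ
  ⊑-step : ∀ {τ τ′} a b → a < b → lookup τ a < lookup τ b → swapAt τ a b ⊑ τ′ → τ ⊑ τ′

-- The greedy step of a chain from τ to τ′: raise the entry at a, without exceeding its final value.
Climb : (τ τ′ : Vec (Fin k) m) → Fin m → Fin m → Set
Climb τ τ′ a b = a < b × lookup τ a < lookup τ b × lookup τ b ≤ lookup τ′ a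

climb? : ∀ (τ τ′ : Vec (Fin k) m) a b → Dec (Climb τ τ′ a b)
climb? τ τ′ a b = (a <? b) ×-dec ((lookup τ a <? lookup τ b) ×-dec (lookup τ b ≤? lookup τ′ a))

nextClimb : (τ τ′ : Vec (Fin k) m) → Maybe (∃[ a ] ∃[ b ] Climb τ τ′ a b)
nextClimb {m = m} τ τ′ = List.head (mapMaybe try (positionPairs m))
  where
  try : Fin m × Fin m → Maybe (∃[ a ] ∃[ b ] Climb τ τ′ a b)
  try (a , b) = Maybe.map (λ c → a , b , c) (dec⇒maybe (climb? τ τ′ a b))

-- Soundness is in the type; that the greedy search succeeds in each required case is found by
-- evaluation.
chain : ℕ → (τ τ′ : Vec (Fin k) m) → Maybe (τ ⊑ τ′)
chain fuel τ τ′ with Vec.≡-dec _≟_ τ τ′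
... | yes refl = just ⊑-refl
chain zero τ τ′ | no _ = nothing
chain (suc fuel) τ τ′ | no _ with nextClimb τ τ′
... | nothing = nothing
... | just (a , b , a<b , lt , _) = Maybe.map (⊑-step a b a<b lt) (chain fuel (swapAt τ a b) τ′)

-- The fuel 10 is the length of the longest chain in S₅; a record keeps the search from unfolding in types.
record Below (τ τ′ : Vec (Fin k) m) : Set where
  constructor found
  field chain-found : T (is-just (chain 10 τ τ′))

below? : ∀ (τ τ′ : Vec (Fin k) m) → Dec (Below τ τ′)
below? τ τ′ = map′ found Below.chain-found (T? _)

below⇒⊑ : ∀ {τ τ′ : Vec (Fin k) m} → Below τ τ′ → τ ⊑ τ′
below⇒⊑ {τ = τ} {τ′} (found is-found) = to-witness-T (chain 10 τ τ′) is-found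

Asc : Vec (Fin k) m → Fin m → Fin m → Set
Asc τ a b = (a < b × lookup τ a < lookup τ b) ⊎ (b < a × lookup τ b < lookup τ a)

asc? : ∀ (τ : Vec (Fin k) m) a b → Dec (Asc τ a b)
asc? τ a b = ((a <? b) ×-dec (lookup τ a <? lookup τ b)) ⊎-dec ((b <? a) ×-dec (lookup τ b <? lookup τ a))

-- The pattern σ with one more point, at position c and with value v.
insertPoint : Vec (Fin m) m → (c v : Fin (suc m)) → Vec (Fin (suc m)) (suc m)
insertPoint σ c v = tabulate (insertAt (punchIn v ∘ lookup σ) c v)

decreasing : Vec (Fin 4) 4
decreasing = suc (suc (suc zero)) ∷ suc (suc zero) ∷ suc zero ∷ zero ∷ []

assoc : Fin m → List (Fin m × Fin m) → Fin m
assoc q []             = q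
assoc q ((x , y) ∷ xs) with q ≟ x
... | yes _ = y
... | no  _ = assoc q xs

-- On either side of the position c of the inserted point, the k-th nearest position ascending with c
-- goes to the k-th nearest position (the value on other positions is irrelevant).
nearest : Vec (Fin m) m → (c v : Fin (suc m)) → Fin m → Fin m
-- Positions left of `c` are reversed, so that on both sides the list starts next to `c`.
nearest {m} σ c v q = assoc q (match (reverse (filter (λ a → punchIn c a <? c) (allFin m)))
                            ++ match (filter (λ a → c <? punchIn c a) (allFin m)))
  where
  match : List (Fin m) → List (Fin m × Fin m)
  -- The keys are a sublist of `qs`, so `zip` drops none of them and pairs the k-th key with the
  -- k-th position.
  match qs = zip (filter (λ a → asc? (insertPoint σ c v) c (punchIn c a)) qs) qs

Between : (c a a′ : Fin m) → Set
Between c a a′ = (a ≤ a′ × a′ < c) ⊎ (c < a′ × a′ ≤ a)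

-- For an edge with one end in the pattern, the three conjuncts yield in turn that the moved edge is
-- an h-edge, that it leads above `w`, and that moving is injective.
CrossAt : Vec (Fin 4) 4 → (c v : Fin 5) → Fin 4 → Set
CrossAt σ c v q = Asc (insertPoint σ c v) c (punchIn c q) →
    Between c (punchIn c q) (punchIn c q′)
  × Below (insertPoint σ c v) (swapAt (insertPoint decreasing c v) c (punchIn c q′))
  × (∀ r → Asc (insertPoint σ c v) c (punchIn c r) → nearest σ c v r ≡ q′ → r ≡ q)
  where q′ = nearest σ c v q

Cross : Vec (Fin 4) 4 → Set
Cross σ = ∀ c v q → CrossAt σ c v q

cross? : ∀ σ → Dec (Cross σ)
cross? σ = all? λ c → all? λ v → all? λ q → let q′ = nearest σ c v q in
  asc? (insertPoint σ c v) c (punchIn c q) →-dec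
    ((((punchIn c q ≤? punchIn c q′) ×-dec (punchIn c q′ <? c)) ⊎-dec ((c <? punchIn c q′) ×-dec (punchIn c q′ ≤? punchIn c q)))
    ×-dec (below? _ _ ×-dec all? (λ r → asc? (insertPoint σ c v) c (punchIn c r) →-dec ((nearest σ c v r ≟ q′) →-dec (r ≟ q)))))

-- The bound `d` carries the conditions on `h` that forbid long edges inside the pattern into the
-- finite check.
InnerAsc : Vec (Fin 4) 4 → ℕ → Fin 4 → Fin 4 → Set
InnerAsc σ d a b = a < b × lookup σ a < lookup σ b × toℕ b ℕ.≤ d ℕ.+ toℕ a

innerAsc? : ∀ σ d a b → Dec (InnerAsc σ d a b)
innerAsc? σ d a b = (a <? b) ×-dec ((lookup σ a <? lookup σ b) ×-dec (toℕ b ℕ.≤? d ℕ.+ toℕ a))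

-- The ascending edges of σ of length at most d are moved injectively by g; the edge xy is left over.
Inner : Vec (Fin 4) 4 → ℕ → (Fin 4 × Fin 4 → Fin 4 × Fin 4) → Fin 4 × Fin 4 → Set
Inner σ d g xy@(x , y) = x < y × Below σ (swapAt decreasing x y) ×
  ∀ a b → InnerAsc σ d a b → let (a′ , b′) = g (a , b) in
      (a ≤ a′ × a′ < b′ × b′ ≤ b)
    × Below σ (swapAt decreasing a′ b′)
    × g (a , b) ≢ xy
    × (∀ a₁ b₁ → InnerAsc σ d a₁ b₁ → g (a₁ , b₁) ≡ g (a , b) → (a₁ , b₁) ≡ (a , b))

inner? : ∀ σ d g xy → Dec (Inner σ d g xy)
inner? σ d g xy@(x , y) = (x <? y) ×-dec (below? _ _ ×-dec (all? λ a → all? λ b → innerAsc? σ d a b →-dec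
  (((a ≤? _) ×-dec ((_ <? _) ×-dec (_ ≤? b))) ×-dec (below? _ _ ×-dec (¬? (g (a , b) ≟² xy) ×-dec
    (all? λ a₁ → all? λ b₁ → innerAsc? σ d a₁ b₁ →-dec ((g (a₁ , b₁) ≟² g (a , b)) →-dec ((a₁ , b₁) ≟² (a , b)))))))))
  where
  _≟²_ : (p q : Fin 4 × Fin 4) → Dec (p ≡ q)
  _≟²_ = ≡-dec _≟_ _≟_

reroute : (s t p : Fin 4 × Fin 4) → Fin 4 × Fin 4
reroute s t p with ≡-dec _≟_ _≟_ p s
... | yes _ = t
... | no  _ = p

-- Surjectivity makes `σ` a permutation, so that no position outside the pattern carries one of its
-- four values.
IsPattern : Vec (Fin 4) 4 → ℕ → (Fin 4 × Fin 4 → Fin 4 × Fin 4) → Fin 4 × Fin 4 → Set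
IsPattern σ d g xy = (∀ b → ∃[ a ] lookup σ a ≡ b) × Below σ decreasing × Cross σ × Inner σ d g xy

isPattern? : ∀ σ d g xy → Dec (IsPattern σ d g xy)
isPattern? σ d g xy = (all? λ b → any? λ a → lookup σ a ≟ b) ×-dec (below? _ _ ×-dec (cross? σ ×-dec inner? σ d g xy))

-- Embedding small permutations

module _ {f : Fin m → Fin n} (mono : StrictMono f) where

  strictMono⇒injective : ∀ {a b} → f a ≡ f b → a ≡ b
  strictMono⇒injective {a} {b} eq with <-cmp a b
  ... | tri< a<b _ _ = contradiction eq (<⇒≢ (mono a<b))
  ... | tri≈ _ a≡b _ = a≡b
  ... | tri> _ _ b<a = contradiction (sym eq) (<⇒≢ (mono b<a))

  strictMono-reflects-< : ∀ {a b} → f a < f b → a < b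
  strictMono-reflects-< {a} {b} fa<fb with <-cmp a b
  ... | tri< a<b _ _  = a<b
  ... | tri≈ _ refl _ = contradiction fa<fb (<-irrefl refl)
  ... | tri> _ _ b<a  = contradiction fa<fb (<-asym (mono b<a))

  strictMono⇒mono : ∀ {a b} → a ≤ b → f a ≤ f b
  strictMono⇒mono {a} {b} a≤b with <-cmp a b
  ... | tri< a<b _ _  = ℕ.<⇒≤ (mono a<b)
  ... | tri≈ _ refl _ = ℕ.≤-refl
  ... | tri> _ _ b<a  = contradiction a≤b (ℕ.<⇒≱ b<a)

lookup-swapAtˡ : ∀ (τ : Vec (Fin k) m) {a b} → a ≢ b → lookup (swapAt τ a b) a ≡ lookup τ b
lookup-swapAtˡ τ {a} {b} a≢b = trans (lookup∘update′ a≢b (τ [ a ]≔ _) _) (lookup∘update a τ _)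

lookup-swapAtʳ : ∀ (τ : Vec (Fin k) m) a b → lookup (swapAt τ a b) b ≡ lookup τ a
lookup-swapAtʳ τ a b = lookup∘update b (τ [ a ]≔ _) _

lookup-swapAt-≢ : ∀ (τ : Vec (Fin k) m) {a b c} → c ≢ a → c ≢ b → lookup (swapAt τ a b) c ≡ lookup τ c
lookup-swapAt-≢ τ {a} {b} c≢a c≢b = trans (lookup∘update′ c≢b (τ [ a ]≔ lookup τ b) _) (lookup∘update′ c≢a τ _)

Off : (Fin m → Fin n) → Fin n → Set
Off e x = ∀ a → e a ≢ x

locate : ∀ (e : Fin m → Fin n) x → (∃[ a ] e a ≡ x) ⊎ Off e x
locate e x with any? (λ a → e a ≟ x)
... | yes x∈e = inj₁ x∈e
... | no  x∉e = inj₂ λ a eq → x∉e (a , eq)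

AgreeOff : (Fin m → Fin n) → Perm n → Perm n → Set
AgreeOff e u v = ∀ x → Off e x → u at x ≡ v at x

Embeds : (Fin m → Fin n) → (Fin k → Fin n) → Perm n → Vec (Fin k) m → Set
Embeds e val u τ = ∀ a → u at e a ≡ val (lookup τ a)

module _ {e : Fin m → Fin n} {val : Fin k → Fin n} (e-mono : StrictMono e) (val-mono : StrictMono val) where

  embeds-swap : ∀ {u τ a b} → a ≢ b → Embeds e val u τ → Embeds e val (swapPos u (e a) (e b)) (swapAt τ a b)
  embeds-swap {u} {τ} {a} {b} a≢b emb c with c ≟ a | c ≟ b
  ... | yes refl | _ = trans (cong (u at_) (transpose-ˡ (e a) (e b)))
                         (trans (emb b) (cong val (sym (lookup-swapAtˡ τ a≢b))))
  ... | no _ | yes refl = trans (cong (u at_) (transpose-ʳ (e a) (e b)))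
                         (trans (emb a) (cong val (sym (lookup-swapAtʳ τ a b))))
  ... | no c≢a | no c≢b =
    trans (cong (u at_) (transpose-≢ (e a) (e b) (c≢a ∘ strictMono⇒injective e-mono) (c≢b ∘ strictMono⇒injective e-mono)))
          (trans (emb c) (cong val (sym (lookup-swapAt-≢ τ c≢a c≢b))))

  agreeOff-swap : ∀ (u : Perm n) a b → AgreeOff e u (swapPos u (e a) (e b))
  agreeOff-swap u a b x off = cong (u at_) (sym (transpose-≢ (e a) (e b) (off a ∘ sym) (off b ∘ sym)))

  -- Both embeddings are increasing, so each ascent of the small permutation is an ascent of the
  -- large one at the embedded positions, and nothing else moves.
  ⊑-lift : ∀ {u τ τ′} → Embeds e val u τ → τ ⊑ τ′ → ∃[ v ] (u ≼ v × Embeds e val v τ′ × AgreeOff e u v)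
  ⊑-lift {u} emb ⊑-refl = u , ≼-refl (λ _ → refl) , emb , λ _ _ → refl
  ⊑-lift {u} {τ} emb (⊑-step a b a<b lt τ⊑) =
    let v , x≼v , emb-v , agree = ⊑-lift {swapPos u (e a) (e b)} (embeds-swap {u} {τ} (<⇒≢ a<b) emb) τ⊑
    in v
     , ≼-step (swapPos-step u (e-mono a<b) (subst₂ _<_ (sym (emb a)) (sym (emb b)) (val-mono lt))) x≼v
     , emb-v
     , λ x off → trans (agreeOff-swap u a b x off) (agree x off)

  embeds-unique : ∀ {u v τ} → Embeds e val u τ → Embeds e val v τ → AgreeOff e u v → u ≈ v
  embeds-unique emb-u emb-v agree x with locate e x
  ... | inj₁ (a , refl) = trans (emb-u a) (sym (emb-v a))
  ... | inj₂ off        = agree x off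

  ⊑⇒≼ : ∀ {u v τ τ′} → Embeds e val u τ → Embeds e val v τ′ → AgreeOff e u v → τ ⊑ τ′ → u ≼ v
  ⊑⇒≼ {u} {v} {τ} {τ′} emb-u emb-v agree τ⊑τ′ =
    let x , u≼x , emb-x , agree-x = ⊑-lift emb-u τ⊑τ′
    in ≼-respʳ-≈ u≼x (embeds-unique {x} {v} {τ′} emb-x emb-v (λ y off → trans (sym (agree-x y off)) (agree y off)))

-- For increasing `f` this counts the values below `x`: the place where `x` has to be inserted.
slot : (Fin m → Fin n) → Fin n → Fin (suc m)
slot {zero}  f x = zero
slot {suc m} f x with f zero <? x
... | yes _ = suc (slot (f ∘ suc) x)
... | no  _ = zero

insertAt-strictMono : ∀ (f : Fin m → Fin n) {x} → StrictMono f → Off f x → StrictMono (insertAt f (slot f x) x)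
insertAt-strictMono {zero}  f mono off {zero} {zero} ()
insertAt-strictMono {suc m} f {x} mono off {a} {b} a<b with f zero <? x
insertAt-strictMono {suc m} f {x} mono off {zero} {suc b} a<b | yes f0<x = below f0<x b
  where
  below : f zero < x → ∀ b → f zero < insertAt (f ∘ suc) (slot (f ∘ suc) x) x b
  below f0<x b with slot (f ∘ suc) x ≟ b
  ... | yes refl = subst (f zero <_) (sym (insertAt-lookup (f ∘ suc) b x)) f0<x
  ... | no  s≢b  = subst (λ c → f zero < insertAt (f ∘ suc) (slot (f ∘ suc) x) x c) (punchIn-punchOut s≢b)
    (subst (f zero <_) (sym (insertAt-punchIn (f ∘ suc) (slot (f ∘ suc) x) x (punchOut s≢b))) (mono (s≤s z≤n)))
insertAt-strictMono {suc m} f {x} mono off {suc a} {suc b} (s≤s a<b) | yes _ =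
  insertAt-strictMono (f ∘ suc) (mono ∘ s≤s) (off ∘ suc) a<b
insertAt-strictMono {suc m} f {x} mono off {zero} {suc b} a<b | no f0≮x = ℕ.<-≤-trans x<f0 (strictMono⇒mono mono {zero} {b} z≤n)
  where
  x<f0 : x < f zero
  x<f0 with <-cmp (f zero) x
  ... | tri< lt _ _ = contradiction lt f0≮x
  ... | tri≈ _ eq _ = contradiction eq (off zero)
  ... | tri> _ _ gt = gt
insertAt-strictMono {suc m} f {x} mono off {suc a} {suc b} (s≤s a<b) | no _ = mono a<b

embeds-insert : ∀ {e val : Fin m → Fin n} {u σ} c v p → Embeds e val u σ →
                Embeds (insertAt e c p) (insertAt val v (u at p)) u (insertPoint σ c v)
embeds-insert {e = e} {val} {u} {σ} c v p emb a
  rewrite lookup∘tabulate (insertAt (punchIn v ∘ lookup σ) c v) a with c ≟ a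
... | yes refl rewrite insertAt-lookup e c p | insertAt-lookup (punchIn v ∘ lookup σ) c v = sym (insertAt-lookup val v (u at p))
... | no c≢a = subst (λ a → u at insertAt e c p a ≡ insertAt val v (u at p) (insertAt (punchIn v ∘ lookup σ) c v a))
                     (punchIn-punchOut c≢a) (at-punchIn (punchOut c≢a))
  where
  at-punchIn : ∀ b → u at insertAt e c p (punchIn c b) ≡ insertAt val v (u at p) (insertAt (punchIn v ∘ lookup σ) c v (punchIn c b))
  at-punchIn b rewrite insertAt-punchIn e c p b | insertAt-punchIn (punchIn v ∘ lookup σ) c v b
    | insertAt-punchIn val v (u at p) (lookup σ b) = emb b

-- Comparing degrees

SamePair : Fin n × Fin n → Fin n × Fin n → Set
SamePair (i , j) (k , l) = (i ≡ k × j ≡ l) ⊎ (i ≡ l × j ≡ k)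

swapPair : Perm n → Fin n × Fin n → Perm n
swapPair u (i , j) = swapPos u i j

swapPair-cong : ∀ (u : Perm n) {p q} → SamePair p q → swapPair u p ≈ swapPair u q
swapPair-cong u (inj₁ (refl , refl)) x = refl
swapPair-cong u {i , j} (inj₂ (refl , refl)) x = cong (u at_) (transpose-comm i j x)

-- Evaluation at `i` alone decides: the second transposition must also send `i` to `j`, and `i ≢ j`.
swapPair-injective : ∀ (u : Perm n) {i j q} → i ≢ j → swapPair u (i , j) ≈ swapPair u q → SamePair (i , j) q
swapPair-injective u {i} {j} {k , l} i≢j eq with at-injective u (eq i) | transposeView k l i
... | ti | first  i≡k t = inj₁ (i≡k , trans (sym (transpose-ˡ i j)) (trans ti t))
... | ti | second i≡l t = inj₂ (i≡l , trans (sym (transpose-ˡ i j)) (trans ti t))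
... | ti | other _ _ t  = contradiction (sym (trans (sym (transpose-ˡ i j)) (trans ti t))) i≢j

-- Unordered versions: i and j may come in either order.
Edge : Hessenberg n → Fin n × Fin n → Set
Edge H (i , j) = (i < j × j ≤ h H i) ⊎ (j < i × i ≤ h H j)

Ascending : Perm n → Fin n × Fin n → Set
Ascending u (i , j) = (i < j × u at i < u at j) ⊎ (j < i × u at j < u at i)

edge⇒≢ : ∀ (H : Hessenberg n) {i j} → Edge H (i , j) → i ≢ j
edge⇒≢ H (inj₁ (i<j , _)) = <⇒≢ i<j
edge⇒≢ H (inj₂ (j<i , _)) = <⇒≢ j<i ∘ sym

edge⇒adjacent : ∀ (H : Hessenberg n) (u : Perm n) {p} → Edge H p → Adjacent H u (swapPair u p)
edge⇒adjacent H u (inj₁ (i<j , j≤)) = _ , _ , i<j , j≤ , λ _ → refl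
edge⇒adjacent H u {i , j} (inj₂ (j<i , i≤)) = _ , _ , j<i , i≤ , λ x → cong (u at_) (transpose-comm i j x)

-- A neighbour of w in [w , w₀] is w (i j) for an ascending h-edge (i j); hence an injection from
-- ascending h-edges of w to h-edges of u leading into [w , w₀] that misses one of the latter
-- shows deg w < deg u.
module Transfer (H : Hessenberg n) (w u : Perm n) (w≼u : w ≼ u)
  (K : Set) (source target : K → Fin n × Fin n) (Valid : K → Set)
  (classify : ∀ {i j} → i < j → j ≤ h H i → w at i < w at j → ∃[ κ ] (Valid κ × SamePair (source κ) (i , j)))
  (target-good : ∀ {κ} → Valid κ → Edge H (target κ) × w ≼ swapPair u (target κ))
  (target-injective : ∀ {κ κ′} → Valid κ → Valid κ′ → SamePair (target κ) (target κ′) → SamePair (source κ) (source κ′))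
  (extra : Fin n × Fin n) (extra-good : Edge H extra × w ≼ swapPair u extra)
  (extra-missed : ∀ {κ} → Valid κ → ¬ SamePair (target κ) extra)
  where

  notRegular : ¬ IsRegular H w
  notRegular (d , regular)
    -- Both degrees are `d`, so an injection of neighbours that misses one gives `d < d`.
    with fw , fw-inj , fw-nbr , _ ← regular w (≼-refl (λ _ → refl) , ≼-w₀ w)
       | fu , _ , _ , fu-all ← regular u (w≼u , ≼-w₀ u)
    = ℕ.<-irrefl refl (injective-missing⇒< f (proj₁ extraNbr) f-inj f-miss)
    where
    nbr : ∀ {p} → Edge H p × w ≼ swapPair u p → ∃[ b ] (fu b ≈ swapPair u p)
    nbr {p} (e , w≼) = fu-all (swapPair u p) (w≼ , ≼-w₀ _) (edge⇒adjacent H u e)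
    extraNbr : ∃[ b ] (fu b ≈ swapPair u extra)
    extraNbr = nbr extra-good
    kind : ∀ a → ∃[ κ ] (Valid κ × fw a ≈ swapPair w (source κ))
    kind a with (w≼ , _) , i , j , i<j , j≤ , eq ← fw-nbr a
      = let κ , valid , same = classify i<j j≤ (≼-swapPos⇒< w {fw a} i<j eq w≼)
        in κ , valid , λ x → trans (eq x) (sym (swapPair-cong w same x))
    kd : Fin d → K
    kd a = proj₁ (kind a)
    valid : ∀ a → Valid (kd a)
    valid a = proj₁ (proj₂ (kind a))
    f : Fin d → Fin d
    f a = proj₁ (nbr (target-good (valid a)))
    f-at : ∀ a → fu (f a) ≈ swapPair u (target (kd a))
    f-at a = proj₂ (nbr (target-good (valid a)))
    same-target : ∀ a {b q} → fu b ≈ swapPair u q → f a ≡ b → SamePair (target (kd a)) q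
    same-target a fu-b refl = swapPair-injective u (edge⇒≢ H (proj₁ (target-good (valid a))))
      (λ x → trans (sym (f-at a x)) (fu-b x))
    f-inj : ∀ {a b} → f a ≡ f b → a ≡ b
    f-inj {a} {b} eq = fw-inj a b λ x →
      trans (proj₂ (proj₂ (kind a)) x)
      (trans (swapPair-cong w (target-injective (valid a) (valid b) (same-target a (f-at b) eq)) x)
             (sym (proj₂ (proj₂ (kind b)) x)))
    f-miss : ∀ a → f a ≢ proj₁ extraNbr
    f-miss a eq = extra-missed (valid a) (same-target a (proj₂ extraNbr) eq)

-- From the finite checks to an injection of edges

Reach : Hessenberg n → (Fin 4 → Fin n) → ℕ → Set
Reach H P d = ∀ a b → P b ≤ h H (P a) → toℕ b ℕ.≤ d ℕ.+ toℕ a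

module _ (H : Hessenberg n) (w : Perm n) {P V : Fin 4 → Fin n} (P-mono : StrictMono P) (V-mono : StrictMono V)
  {σ : Vec (Fin 4) 4} (emb : Embeds P V w σ)
  {d : ℕ} {g : Fin 4 × Fin 4 → Fin 4 × Fin 4} {xy : Fin 4 × Fin 4} (isPattern : IsPattern σ d g xy)
  (reach : Reach H P d)
  (extra-edge : P (proj₂ xy) ≤ h H (P (proj₁ xy)))
  where

  private
    σ-surjective : ∀ b → ∃[ a ] lookup σ a ≡ b
    σ-surjective = proj₁ isPattern
    below-decreasing : Below σ decreasing
    below-decreasing = proj₁ (proj₂ isPattern)
    cross-ok : Cross σ
    cross-ok = proj₁ (proj₂ (proj₂ isPattern))
    inner-ok : Inner σ d g xy
    inner-ok = proj₂ (proj₂ (proj₂ isPattern))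
    -- Lifting the chain from `σ` to `decreasing` constructs `u` and proves `w ≼ u` at once.
    u-spec : ∃[ u ] (w ≼ u × Embeds P V u decreasing × AgreeOff P w u)
    u-spec = ⊑-lift P-mono V-mono {w} {σ} emb (below⇒⊑ below-decreasing)
    u : Perm n
    u = proj₁ u-spec
    w≼u : w ≼ u
    w≼u = proj₁ (proj₂ u-spec)
    emb-u : Embeds P V u decreasing
    emb-u = proj₁ (proj₂ (proj₂ u-spec))
    agree : AgreeOff P w u
    agree = proj₂ (proj₂ (proj₂ u-spec))

    -- Edges with no, one or two ends in the pattern. In `cross` the outside position comes first
    -- even if it is the larger one, which is why edges are treated as unordered.
    data Kind : Set where
      outer : Fin n → Fin n → Kind
      cross : Fin n → Fin 4 → Kind
      inner : Fin 4 → Fin 4 → Kind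

    P² : Fin 4 × Fin 4 → Fin n × Fin n
    P² (a , b) = P a , P b

    near : Fin n → Fin 4 → Fin 4
    near p = nearest σ (slot P p) (slot V (w at p))

    source target : Kind → Fin n × Fin n
    source (outer i j) = i , j
    source (cross p q) = p , P q
    source (inner a b) = P² (a , b)
    target (outer i j) = i , j
    target (cross p q) = p , P (near p q)
    target (inner a b) = P² (g (a , b))

    Shape : Kind → Set
    Shape (outer i j) = Off P i × Off P j
    Shape (cross p q) = Off P p
    Shape (inner a b) = a < b

    Valid : Kind → Set
    Valid κ = Shape κ × Edge H (source κ) × Ascending w (source κ)

    classify : ∀ {i j} → i < j → j ≤ h H i → w at i < w at j → ∃[ κ ] (Valid κ × SamePair (source κ) (i , j))
    classify {i} {j} i<j j≤ asc = go (locate P i) (locate P j)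
      where
      go : (∃[ a ] P a ≡ i) ⊎ Off P i → (∃[ b ] P b ≡ j) ⊎ Off P j → ∃[ κ ] (Valid κ × SamePair (source κ) (i , j))
      go (inj₂ i∉) (inj₂ j∉) = outer i j , ((i∉ , j∉) , inj₁ (i<j , j≤) , inj₁ (i<j , asc)) , inj₁ (refl , refl)
      go (inj₂ i∉) (inj₁ (q , refl)) = cross i q , (i∉ , inj₁ (i<j , j≤) , inj₁ (i<j , asc)) , inj₁ (refl , refl)
      go (inj₁ (q , refl)) (inj₂ j∉) = cross j q , (j∉ , inj₂ (i<j , j≤) , inj₂ (i<j , asc)) , inj₂ (refl , refl)
      go (inj₁ (a , refl)) (inj₁ (b , refl)) =
        inner a b , (strictMono-reflects-< P-mono i<j , inj₁ (i<j , j≤) , inj₁ (i<j , asc)) , inj₁ (refl , refl)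

    V-off : ∀ {p} → Off P p → Off V (w at p)
    V-off p∉ b eq = let a , σa≡b = σ-surjective b in
      p∉ a (at-injective w (trans (emb a) (trans (cong V σa≡b) eq)))

    module AtSlot {p} (p∉ : Off P p) where
      c v : Fin 5
      c = slot P p
      v = slot V (w at p)
      e val : Fin 5 → Fin n
      e = insertAt P c p
      val = insertAt V v (w at p)
      e-mono : StrictMono e
      e-mono = insertAt-strictMono P P-mono p∉
      val-mono : StrictMono val
      val-mono = insertAt-strictMono V V-mono (V-off p∉)
      e-slot : e c ≡ p
      e-slot = insertAt-lookup P c p
      e-punchIn : ∀ q → e (punchIn c q) ≡ P q
      e-punchIn = insertAt-punchIn P c p
      emb-w₅ : Embeds e val w (insertPoint σ c v)
      emb-w₅ = embeds-insert {e = P} {V} {w} {σ} c v p emb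
      -- Since `u` and `w` agree at `p`, the same slot `v` and the same `val` serve for both.
      emb-u₅ : Embeds e val u (insertPoint decreasing c v)
      emb-u₅ = subst (λ y → Embeds e (insertAt V v y) u (insertPoint decreasing c v)) (sym (agree p p∉))
                 (embeds-insert {e = P} {V} {u} {decreasing} c v p emb-u)

      asc₅ : ∀ {q} → Ascending w (p , P q) → Asc (insertPoint σ c v) c (punchIn c q)
      asc₅ {q} asc = lower (subst₂ (λ x y → Ascending w (x , y)) (sym e-slot) (sym (e-punchIn q)) asc)
        where
        lower : ∀ {a b} → Ascending w (e a , e b) → Asc (insertPoint σ c v) a b
        lower {a} {b} (inj₁ (lt , asc)) = inj₁ (strictMono-reflects-< e-mono lt
          , strictMono-reflects-< val-mono (subst₂ _<_ (emb-w₅ a) (emb-w₅ b) asc))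
        lower {a} {b} (inj₂ (lt , asc)) = inj₂ (strictMono-reflects-< e-mono lt
          , strictMono-reflects-< val-mono (subst₂ _<_ (emb-w₅ b) (emb-w₅ a) asc))

      -- Left of `p` the smaller end moves up and `h` is nondecreasing; right of `p` the larger end
      -- moves down.
      closer-edge : ∀ {q r} → Between c (punchIn c q) (punchIn c r) → Edge H (p , P q) → Edge H (p , P r)
      closer-edge {q} {r} (inj₁ (q≤r , r<c)) edge = back edge
        where
        Pq≤Pr : P q ≤ P r
        Pq≤Pr = subst₂ _≤_ (e-punchIn q) (e-punchIn r) (strictMono⇒mono e-mono q≤r)
        Pr<p : P r < p
        Pr<p = subst₂ _<_ (e-punchIn r) e-slot (e-mono r<c)
        back : Edge H (p , P q) → Edge H (p , P r)
        back (inj₁ (p<Pq , _)) = contradiction (ℕ.<-≤-trans p<Pq Pq≤Pr) (<-asym Pr<p)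
        back (inj₂ (_ , p≤))   = inj₂ (Pr<p , ℕ.≤-trans p≤ (monotone H Pq≤Pr))
      closer-edge {q} {r} (inj₂ (c<r , r≤q)) edge = forth edge
        where
        Pr≤Pq : P r ≤ P q
        Pr≤Pq = subst₂ _≤_ (e-punchIn r) (e-punchIn q) (strictMono⇒mono e-mono r≤q)
        p<Pr : p < P r
        p<Pr = subst₂ _<_ e-slot (e-punchIn r) (e-mono c<r)
        forth : Edge H (p , P q) → Edge H (p , P r)
        forth (inj₁ (_ , Pq≤)) = inj₁ (p<Pr , ℕ.≤-trans Pr≤Pq Pq≤)
        forth (inj₂ (Pq<p , _)) = contradiction (ℕ.≤-<-trans Pr≤Pq Pq<p) (<-asym p<Pr)

      good : ∀ {r} → Below (insertPoint σ c v) (swapAt (insertPoint decreasing c v) c (punchIn c r)) → w ≼ swapPos u p (P r)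
      good {r} below = subst₂ (λ x y → w ≼ swapPos u x y) e-slot (e-punchIn r)
        (⊑⇒≼ e-mono val-mono {w} {_} {insertPoint σ c v} {_} emb-w₅
          (embeds-swap e-mono val-mono {u} {insertPoint decreasing c v} (punchInᵢ≢i c r ∘ sym) emb-u₅)
          agree₅ (below⇒⊑ below))
        where
        agree₅ : AgreeOff e w (swapPos u (e c) (e (punchIn c r)))
        agree₅ x off = trans (agree x (λ a eq → off (punchIn c a) (trans (e-punchIn a) eq)))
                             (agreeOff-swap e-mono val-mono u c (punchIn c r) x off)

    inner-edge : ∀ {a b} → a < b → Edge H (P a , P b) → P b ≤ h H (P a)
    inner-edge a<b (inj₁ (_ , le)) = le
    inner-edge a<b (inj₂ (gt , _)) = contradiction gt (<-asym (P-mono a<b))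

    inner-asc : ∀ {a b} → Valid (inner a b) → InnerAsc σ d a b
    inner-asc {a} {b} (a<b , edge , asc) = a<b , σa<σb asc , reach a b (inner-edge a<b edge)
      where
      σa<σb : Ascending w (P a , P b) → lookup σ a < lookup σ b
      σa<σb (inj₁ (_ , lt)) = strictMono-reflects-< V-mono (subst₂ _<_ (emb a) (emb b) lt)
      σa<σb (inj₂ (gt , _)) = contradiction gt (<-asym (P-mono a<b))

    inner-good : ∀ {a b} → a < b → P b ≤ h H (P a) → Below σ (swapAt decreasing a b) →
                 Edge H (P² (a , b)) × w ≼ swapPair u (P² (a , b))
    inner-good {a} {b} a<b le below = inj₁ (P-mono a<b , le) ,
      ⊑⇒≼ P-mono V-mono {w} {swapPos u (P a) (P b)} {σ} emb (embeds-swap P-mono V-mono {u} {decreasing} (<⇒≢ a<b) emb-u)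
        (λ x off → trans (agree x off) (agreeOff-swap P-mono V-mono u a b x off)) (below⇒⊑ below)

    P²-injective : ∀ {p q : Fin 4 × Fin 4} → proj₁ p < proj₂ p → proj₁ q < proj₂ q → SamePair (P² p) (P² q) → p ≡ q
    P²-injective _ _ (inj₁ (eq₁ , eq₂)) = cong₂ _,_ (strictMono⇒injective P-mono eq₁) (strictMono⇒injective P-mono eq₂)
    P²-injective lt₁ lt₂ (inj₂ (eq₁ , eq₂)) = contradiction
      (subst₂ _<_ (strictMono⇒injective P-mono eq₁) (strictMono⇒injective P-mono eq₂) lt₁) (<-asym lt₂)

    target-good : ∀ {κ} → Valid κ → Edge H (target κ) × w ≼ swapPair u (target κ)
    target-good {outer i j} ((i∉ , j∉) , edge , asc) = edge , ≼-trans w≼u (up asc)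
      where
      up : Ascending w (i , j) → u ≼ swapPos u i j
      up (inj₁ (i<j , lt)) = ≼-step {x = swapPos u i j}
        (swapPos-step u i<j (subst₂ _<_ (agree i i∉) (agree j j∉) lt)) (≼-refl (λ _ → refl))
      up (inj₂ (j<i , lt)) = ≼-step {x = swapPos u j i}
        (swapPos-step u j<i (subst₂ _<_ (agree j j∉) (agree i i∉) lt)) (≼-refl (λ x → cong (u at_) (transpose-comm j i x)))
    target-good {cross p q} (p∉ , edge , asc) =
      let between , below , _ = cross-ok c v q (asc₅ asc) in closer-edge between edge , good below
      where open AtSlot p∉
    target-good {inner a b} valid =
      let (a≤a′ , a′<b′ , b′≤b) , below , _ = proj₂ (proj₂ inner-ok) a b (inner-asc valid)
          Pb≤hPa = inner-edge (proj₁ valid) (proj₁ (proj₂ valid))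
      in inner-good a′<b′ (ℕ.≤-trans (strictMono⇒mono P-mono b′≤b)
           (ℕ.≤-trans Pb≤hPa (monotone H (strictMono⇒mono P-mono a≤a′)))) below

    -- A target has as many ends in the pattern as its source, so only edges of one kind can
    -- collide. Two `cross` edges that collide share `p`, hence `c` and `v`, and the finite check
    -- applies.
    target-injective : ∀ {κ κ′} → Valid κ → Valid κ′ → SamePair (target κ) (target κ′) → SamePair (source κ) (source κ′)
    target-injective {outer _ _} {outer _ _} _ _ same = same
    target-injective {outer _ _} {cross _ q} ((_ , j∉) , _) _ (inj₁ (_ , eq)) = contradiction (sym eq) (j∉ _)
    target-injective {outer _ _} {cross _ q} ((i∉ , _) , _) _ (inj₂ (eq , _)) = contradiction (sym eq) (i∉ _)
    target-injective {outer _ _} {inner _ _} ((i∉ , _) , _) _ (inj₁ (eq , _)) = contradiction (sym eq) (i∉ _)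
    target-injective {outer _ _} {inner _ _} ((i∉ , _) , _) _ (inj₂ (eq , _)) = contradiction (sym eq) (i∉ _)
    target-injective {cross _ _} {outer _ _} _ ((_ , j∉) , _) (inj₁ (_ , eq)) = contradiction eq (j∉ _)
    target-injective {cross _ _} {outer _ _} _ ((i∉ , _) , _) (inj₂ (_ , eq)) = contradiction eq (i∉ _)
    target-injective {cross p q} {cross _ r} (p∉ , _ , asc) (_ , _ , asc′) (inj₁ (refl , eq)) = inj₁ (refl ,
      cong P (proj₂ (proj₂ (cross-ok c v r (asc₅ asc′))) q (asc₅ asc) (strictMono⇒injective P-mono eq)))
      where open AtSlot p∉
    target-injective {cross _ _} {cross _ _} (p∉ , _) _ (inj₂ (eq , _)) = contradiction (sym eq) (p∉ _)
    target-injective {cross _ _} {inner _ _} (p∉ , _) _ (inj₁ (eq , _)) = contradiction (sym eq) (p∉ _)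
    target-injective {cross _ _} {inner _ _} (p∉ , _) _ (inj₂ (eq , _)) = contradiction (sym eq) (p∉ _)
    target-injective {inner _ _} {outer _ _} _ ((i∉ , _) , _) (inj₁ (eq , _)) = contradiction eq (i∉ _)
    target-injective {inner _ _} {outer _ _} _ ((i∉ , _) , _) (inj₂ (_ , eq)) = contradiction eq (i∉ _)
    target-injective {inner _ _} {cross _ _} _ (p∉ , _) (inj₁ (eq , _)) = contradiction eq (p∉ _)
    target-injective {inner _ _} {cross _ _} _ (p∉ , _) (inj₂ (_ , eq)) = contradiction eq (p∉ _)
    target-injective {inner a b} {inner a₁ b₁} valid valid₁ same =
      let (_ , lt , _) , _ , _ , _ = proj₂ (proj₂ inner-ok) a b (inner-asc valid)
          (_ , lt₁ , _) , _ , _ , inj = proj₂ (proj₂ inner-ok) a₁ b₁ (inner-asc valid₁)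
          eq = inj a b (inner-asc valid) (P²-injective lt lt₁ same)
      in inj₁ (cong P (,-injectiveˡ eq) , cong P (,-injectiveʳ eq))

    extra-missed : ∀ {κ} → Valid κ → ¬ SamePair (target κ) (P² xy)
    extra-missed {outer _ _} ((i∉ , _) , _) (inj₁ (eq , _)) = i∉ _ (sym eq)
    extra-missed {outer _ _} ((i∉ , _) , _) (inj₂ (eq , _)) = i∉ _ (sym eq)
    extra-missed {cross _ _} (p∉ , _) (inj₁ (eq , _)) = p∉ _ (sym eq)
    extra-missed {cross _ _} (p∉ , _) (inj₂ (eq , _)) = p∉ _ (sym eq)
    extra-missed {inner a b} valid same =
      let (_ , lt , _) , _ , ≢xy , _ = proj₂ (proj₂ inner-ok) a b (inner-asc valid)
      in ≢xy (P²-injective lt (proj₁ inner-ok) same)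

  pattern⇒notRegular : ¬ IsRegular H w
  pattern⇒notRegular = Transfer.notRegular H w u w≼u Kind source target Valid classify target-good target-injective
    (P² xy) (inner-good (proj₁ inner-ok) extra-edge (proj₁ (proj₂ inner-ok))) extra-missed

-- The seven patterns

all₄ : {Q : Fin 4 → Set} → Q 0F → Q 1F → Q 2F → Q 3F → ∀ a → Q a
all₄ q₀ q₁ q₂ q₃ 0F = q₀
all₄ q₀ q₁ q₂ q₃ 1F = q₁
all₄ q₀ q₁ q₂ q₃ 2F = q₂
all₄ q₀ q₁ q₂ q₃ 3F = q₃

lookup-strictMono : ∀ {i j k l : Fin n} → i < j → j < k → k < l → StrictMono (lookup (i ∷ j ∷ k ∷ l ∷ []))
lookup-strictMono i<j j<k k<l {0F} {1F} _ = i<j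
lookup-strictMono i<j j<k k<l {0F} {2F} _ = <-trans i<j j<k
lookup-strictMono i<j j<k k<l {0F} {3F} _ = <-trans i<j (<-trans j<k k<l)
lookup-strictMono i<j j<k k<l {1F} {2F} _ = j<k
lookup-strictMono i<j j<k k<l {1F} {3F} _ = <-trans j<k k<l
lookup-strictMono i<j j<k k<l {2F} {3F} _ = k<l
lookup-strictMono i<j j<k k<l {1F} {1F} (s≤s ())
lookup-strictMono i<j j<k k<l {2F} {1F} (s≤s ())
lookup-strictMono i<j j<k k<l {2F} {2F} (s≤s (s≤s ()))
lookup-strictMono i<j j<k k<l {3F} {1F} (s≤s ())
lookup-strictMono i<j j<k k<l {3F} {2F} (s≤s (s≤s ()))
lookup-strictMono i<j j<k k<l {3F} {3F} (s≤s (s≤s (s≤s ())))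

reach₃ : ∀ (H : Hessenberg n) (P : Fin 4 → Fin n) → Reach H P 3
reach₃ H P a b _ = ℕ.≤-trans (toℕ≤pred[n] b) (ℕ.m≤m+n 3 (toℕ a))

-- Only the two outermost positions are more than 2 apart, and `far` rules out that edge.
reach₂ : ∀ (H : Hessenberg n) (P : Fin 4 → Fin n) → h H (P 0F) < P 3F → Reach H P 2
reach₂ H P far a b near with short a b
  where
  short : ∀ (a b : Fin 4) → toℕ b ℕ.≤ 2 ℕ.+ toℕ a ⊎ (a ≡ 0F × b ≡ 3F)
  short = toWitness {a? = all? λ a → all? λ b → (toℕ b ℕ.≤? 2 ℕ.+ toℕ a) ⊎-dec ((a ≟ 0F) ×-dec (b ≟ 3F))} _
... | inj₁ le            = le
... | inj₂ (refl , refl) = contradiction near (ℕ.<⇒≱ far)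

-- The longer pairs start at 0 and end at 2 or 3, excluded by `far₀`, or join 1 and 3, excluded by
-- `far₁`.
reach₁ : ∀ (H : Hessenberg n) {P : Fin 4 → Fin n} → StrictMono P →
         h H (P 0F) < P 2F → h H (P 1F) < P 3F → Reach H P 1
reach₁ H {P} P-mono far₀ far₁ a b near with short a b
  where
  short : ∀ (a b : Fin 4) → toℕ b ℕ.≤ 1 ℕ.+ toℕ a ⊎ ((a ≡ 0F × 2 ℕ.≤ toℕ b) ⊎ (a ≡ 1F × b ≡ 3F))
  short = toWitness {a? = all? λ a → all? λ b → (toℕ b ℕ.≤? 1 ℕ.+ toℕ a) ⊎-dec
                            (((a ≟ 0F) ×-dec (2 ℕ.≤? toℕ b)) ⊎-dec ((a ≟ 1F) ×-dec (b ≟ 3F)))} _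
... | inj₁ le                   = le
... | inj₂ (inj₁ (refl , 2≤b))  = contradiction near (ℕ.<⇒≱ (ℕ.<-≤-trans far₀ (strictMono⇒mono P-mono 2≤b)))
... | inj₂ (inj₂ (refl , refl)) = contradiction near (ℕ.<⇒≱ far₁)

-- Swapping the outermost entries of 3210 gives 0213, which is not above 1032; hence that edge is
-- rerouted.
isPattern-2143 : IsPattern (1F ∷ 0F ∷ 3F ∷ 2F ∷ []) 3 (reroute (0F , 3F) (0F , 1F)) (2F , 3F)
isPattern-2143 = toWitness {a? = isPattern? _ _ _ _} _

-- Here 0213 is `σ` itself, so even the outermost edge can be kept.
isPattern-1324 : IsPattern (0F ∷ 2F ∷ 1F ∷ 3F ∷ []) 3 id (1F , 2F)
isPattern-1324 = toWitness {a? = isPattern? _ _ _ _} _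

isPattern-1243 : IsPattern (0F ∷ 1F ∷ 3F ∷ 2F ∷ []) 2 id (2F , 3F)
isPattern-1243 = toWitness {a? = isPattern? _ _ _ _} _

isPattern-2134 : IsPattern (1F ∷ 0F ∷ 2F ∷ 3F ∷ []) 2 id (0F , 1F)
isPattern-2134 = toWitness {a? = isPattern? _ _ _ _} _

-- Keeping the edge from 0 to 2 would give 1230, which is not above 0312.
isPattern-1423 : IsPattern (0F ∷ 3F ∷ 1F ∷ 2F ∷ []) 2 (reroute (0F , 2F) (1F , 2F)) (1F , 3F)
isPattern-1423 = toWitness {a? = isPattern? _ _ _ _} _

-- Keeping the edge from 1 to 3 would give 3012, which is not above 1203.
isPattern-2314 : IsPattern (1F ∷ 2F ∷ 0F ∷ 3F ∷ []) 2 (reroute (1F , 3F) (1F , 2F)) (0F , 2F)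
isPattern-2314 = toWitness {a? = isPattern? _ _ _ _} _

isPattern-2413 : IsPattern (1F ∷ 3F ∷ 0F ∷ 2F ∷ []) 1 id (1F , 2F)
isPattern-2413 = toWitness {a? = isPattern? _ _ _ _} _

theorem3p11 : ∀ (n : ℕ) (H : Hessenberg n) (w : Perm n) →
    IsGenerator H w → ContainsAssociatedPattern H w → ¬ IsRegular H w
theorem3p11 n H w _ (inj₁ (i , j , k , ℓ , i<j , j<k , k<ℓ , ℓ≤hi , a , b , c)) =
  pattern⇒notRegular H w (lookup-strictMono i<j j<k k<ℓ) (lookup-strictMono a b c)
    -- The inequalities `a`, `b`, `c` list the four values increasingly, so the embedding equations
    -- hold by computation.
    (all₄ refl refl refl refl) isPattern-2143 (reach₃ H _)
    -- The leftover edge joins `k` and `ℓ`, with `ℓ ≤ h i ≤ h k`.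
    (ℕ.≤-trans ℓ≤hi (monotone H (ℕ.<⇒≤ (<-trans i<j j<k))))
theorem3p11 n H w _ (inj₂ (inj₁ (i , j , k , ℓ , i<j , j<k , k<ℓ , ℓ≤hj , k≤hi , a , b , c))) =
  pattern⇒notRegular H w (lookup-strictMono i<j j<k k<ℓ) (lookup-strictMono a b c)
    (all₄ refl refl refl refl) isPattern-1324 (reach₃ H _)
    (ℕ.≤-trans (ℕ.<⇒≤ k<ℓ) ℓ≤hj)
theorem3p11 n H w _ (inj₂ (inj₂ (inj₁ (i , j , k , ℓ , i<j , j<k , k<ℓ , ℓ≤hj , _ , hi<ℓ , a , b , c)))) =
  pattern⇒notRegular H w (lookup-strictMono i<j j<k k<ℓ) (lookup-strictMono a b c)
    (all₄ refl refl refl refl) isPattern-1243 (reach₂ H _ hi<ℓ)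
    (ℕ.≤-trans ℓ≤hj (monotone H (ℕ.<⇒≤ j<k)))
theorem3p11 n H w _ (inj₂ (inj₂ (inj₂ (inj₁ (i , j , k , ℓ , i<j , j<k , k<ℓ , _ , k≤hi , hi<ℓ , a , b , c))))) =
  pattern⇒notRegular H w (lookup-strictMono i<j j<k k<ℓ) (lookup-strictMono a b c)
    (all₄ refl refl refl refl) isPattern-2134 (reach₂ H _ hi<ℓ)
    (ℕ.≤-trans (ℕ.<⇒≤ j<k) k≤hi)
theorem3p11 n H w _ (inj₂ (inj₂ (inj₂ (inj₂ (inj₁ (i , j , k , ℓ , i<j , j<k , k<ℓ , ℓ≤hj , _ , hi<ℓ , a , b , c)))))) =
  pattern⇒notRegular H w (lookup-strictMono i<j j<k k<ℓ) (lookup-strictMono a b c)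
    (all₄ refl refl refl refl) isPattern-1423 (reach₂ H _ hi<ℓ) ℓ≤hj
theorem3p11 n H w _ (inj₂ (inj₂ (inj₂ (inj₂ (inj₂ (inj₁ (i , j , k , ℓ , i<j , j<k , k<ℓ , _ , k≤hi , hi<ℓ , a , b , c))))))) =
  pattern⇒notRegular H w (lookup-strictMono i<j j<k k<ℓ) (lookup-strictMono a b c)
    (all₄ refl refl refl refl) isPattern-2314 (reach₂ H _ hi<ℓ) k≤hi
theorem3p11 n H w _ (inj₂ (inj₂ (inj₂ (inj₂ (inj₂ (inj₂ (i , j , k , ℓ , i<j , j≤hi , hi<k , k≤hj , hj<ℓ , ℓ≤hk , a , b , c))))))) =
  pattern⇒notRegular H w P-mono (lookup-strictMono a b c)
    (all₄ refl refl refl refl) isPattern-2413 (reach₁ H P-mono hi<k hj<ℓ) k≤hj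
  where
  P-mono : StrictMono (lookup (i ∷ j ∷ k ∷ ℓ ∷ []))
  -- The order of the positions comes from `j ≤ h i < k ≤ h j < ℓ`.
  P-mono = lookup-strictMono i<j (ℕ.≤-<-trans j≤hi hi<k) (ℕ.≤-<-trans k≤hj hj<ℓ)
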